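{- For all integers $k, n \geq 1$ such that $k = o\left(\frac{\log n}{\log\log n}\right)$, there exists an $(r,t,k)$-cluster packing graph $G$ on $n$ vertices with parameters $$ r = \frac{n}{2k^2}\cdot(1-o(1)) \quad\text{and}\quad t = n^{\Omega(1/\log\log n)}. $$
   Context: A $k$-cluster in a graph is a vertex-disjoint union of $k$-cliques; the number of these cliques is the size of the cluster. An induced $k$-cluster in a graph $G$ is a $k$-cluster $C$ such that the induced subgraph of $G$ on the vertices of $C$ has no edges other than those of $C$, i.e. $G[V(C)]=C$. For $r,t,k\geq 1$, an $(r,t,k)$-cluster packing graph is a graph $G=(V,E)$ whose edges can be partitioned into $t$ separate induced $k$-clusters $C_1,\ldots,C_t$, each of size $r$; additionally, $G$ is required to be $k$-colorable. Asymptotic notation is as $n\to\infty$. -}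

module Defs where

open import Data.Fin.Base using (Fin)
open import Data.Fin.Subset using (Subset; _∈_; ∣_∣)
open import Data.Integer.Base using (+_)
open import Data.Nat.Base using (ℕ; _*_; _^_; _≤_)
open import Data.Nat.Logarithm using (⌊log₂_⌋)
open import Data.Product using (Σ; ∃; ∃!; _×_)
open import Data.Rational.Base as ℚ using (ℚ; 0ℚ; 1ℚ)
open import Function.Bundles using (_⇔_)
open import Level using (0ℓ)
open import Relation.Binary.Core using (Rel)
open import Relation.Binary.Definitions using (Decidable; Irreflexive; Symmetric)
open import Relation.Binary.PropositionalEquality using (_≡_; _≢_)

record Graph (n : ℕ) : Set₁ where
  field
    _~_     : Rel (Fin n) 0ℓ
    ~-sym   : Symmetric _~_
    ~-irr   : Irreflexive _≡_ _~_
    _~?_    : Decidable _~_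

Colorable : ∀ {n} → ℕ → Graph n → Set
Colorable {n} k G = Σ (Fin n → Fin k) λ c → ∀ {u v} → u ~ v → c u ≢ c v
  where open Graph G

-- A vertex-disjoint union of r cliques of order k on vertices from Fin n,
-- given by the vertex sets of the cliques.
record Cluster (n r k : ℕ) : Set where
  field
    clique   : Fin r → Subset n
    order    : ∀ i → ∣ clique i ∣ ≡ k
    disjoint : ∀ {i j v} → v ∈ clique i → v ∈ clique j → i ≡ j

  Vertex : Fin n → Set
  Vertex v = ∃ λ i → v ∈ clique i

  Edge : Rel (Fin n) 0ℓ
  Edge u v = u ≢ v × ∃ λ i → u ∈ clique i × v ∈ clique i

-- Equality of clusters as graphs, i.e. up to the order of the cliques.
_≐_ : ∀ {n r k} → Rel (Cluster n r k) 0ℓ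
C ≐ D = (∀ v → C.Vertex v ⇔ D.Vertex v) × (∀ u v → C.Edge u v ⇔ D.Edge u v)
  where
  module C = Cluster C
  module D = Cluster D

-- G[V(C)] = C.  In particular every edge of C is an edge of G.
Induced : ∀ {n r k} → Graph n → Cluster n r k → Set
Induced G C = ∀ {u v} → Vertex u → Vertex v → (u ~ v) ⇔ Edge u v
  where
  open Graph G
  open Cluster C

record IsClusterPacking {n : ℕ} (r t k : ℕ) (G : Graph n) : Set where
  open Graph G
  field
    r≥1       : 1 ≤ r
    t≥1       : 1 ≤ t
    k≥1       : 1 ≤ k
    cluster   : Fin t → Cluster n r k
    induced   : ∀ i → Induced G (cluster i)
    -- The converse, that edges of clusters are edges of G, is part of `induced`.
    partition : ∀ {u v} → u ~ v → ∃! _≡_ λ i → Cluster.Edge (cluster i) u v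
    -- Follows from `partition` when k ≥ 2; for k = 1 clusters have no edges,
    -- and this excludes repeating one cluster t times.
    distinct  : ∀ {i j} → cluster i ≐ cluster j → i ≡ j
    colorable : Colorable k G

Eventually : ∀ {ℓ} → (ℕ → Set ℓ) → Set ℓ
Eventually P = ∃ λ N → ∀ n → N ≤ n → P n

-- The rounded logarithms ⌊log₂ n⌋ and ⌊log₂ log₂ n⌋ are asymptotically equal
-- to log₂ n and log₂ log₂ n, and a change of base only costs a constant
-- factor, so neither affects a little-o or Ω condition.
lg lglg : ℕ → ℕ
lg   n = ⌊log₂ n ⌋
lglg n = ⌊log₂ ⌊log₂ n ⌋ ⌋

-- f = o(g / h), with the quantifier over ε > 0 taken over ε = 1 / m and
-- denominators cleared.
_=o[_/_] : (f g h : ℕ → ℕ) → Set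
f =o[ g / h ] = ∀ m → Eventually λ n → m * (f n * h n) ≤ g n

_=o[1] : (ℕ → ℚ) → Set
δ =o[1] = ∀ ε → 0ℚ ℚ.< ε → Eventually λ n → ℚ.∣ δ n ∣ ℚ.≤ ε

fromℕ : ℕ → ℚ
fromℕ n = + n ℚ./ 1

-- r = n / (2 k²) · (1 - o(1)), multiplied through by 2 k².
_=n/2_²[1-o[1]] : (r k : ℕ → ℕ) → Set
r =n/2 k ²[1-o[1]] = ∃ λ δ → δ =o[1] ×
  (∀ n → 1 ≤ n → fromℕ (2 * k n ^ 2) ℚ.* fromℕ (r n) ≡ fromℕ n ℚ.* (1ℚ ℚ.- δ n))

-- t ≥ n^(c / log log n) for all large n, where c = 1 / C: both sides are
-- raised to the power C · log log n.  No C = 0 satisfies this.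
_≥n^[1/_loglog] : (t : ℕ → ℕ) (C : ℕ) → Set
t ≥n^[1/ C loglog] = Eventually λ n → n ≤ t n ^ (C * lglg n)

{-# OPTIONS --safe #-}

-- Take a code of words w ∈ [8]^(2b), any two agreeing in at most b places.  On
-- k parts, each a copy of ℤ_p × ℤ_p^(2b × 8) with p = 2kb, let h_w(x) be the sum
-- of x over the graph 1_w of w.  The cluster of w consists of the cliques
--   { (j , h_w(x) + u , x + j 1_w) : j < k },  u < b.
-- Along a clique of w, the value h_w(x) − y of a vertex (j , y , x) moves by 2b per part,
-- while along a clique of another word it moves by at most b.  So a vertex of
-- part j in the cluster of w has h_w(x) − y in the strip 2bj − [0, b), and an
-- edge of another cluster is too short to join two such strips; p = 2kb leaves
-- no room to go round the circle either.  The cluster covers exactly b / p = 1 / 2k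
-- of the vertices.  A greedy code has at least 2^b words, and with b of order
-- log n / log log n one such graph has at most √n vertices, so that disjoint
-- copies of it fill all but √n of the n vertices.
module Submission where

open import Defs
open import Data.Nat.Base
open import Data.Product using (∃; ∃₂; Σ; _×_; _,_; proj₁; proj₂; uncurry)

open import Data.Bool.Base using (if_then_else_; true; false)
open import Data.Fin.Base
  using (Fin; zero; suc; toℕ; fromℕ<; combine; remQuot; finToFun; funToFin; inject≤)
open import Data.Fin.Properties
  using (_≟_; all?; suc-injective; toℕ<n; toℕ-fromℕ<; toℕ-injective; combine-injective;
         remQuot-combine; combine-remQuot; finToFun-funToFin; funToFin-finToFin; inject≤-injective)
  renaming (any? to anyFin?)
open import Data.Fin.Subset using (Subset; inside; _∈_; _∉_; ∣_∣) renaming (⊥ to ∅)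
open import Data.Fin.Subset.Properties using (_∈?_; ∉⊥; ∣⊥∣≡0)
open import Data.Integer.Base as ℤ using (+_; -[1+_]; +[1+_])
import Data.Integer.Properties as ℤ
open import Data.Integer.Solver using () renaming (module +-*-Solver to ℤS)
open import Data.List.Base as List using (List; []; _∷_; _++_; length; map; allFin; cartesianProductWith)
open import Data.List.Membership.Propositional.Properties using (∈-lookup)
open import Data.List.Properties using (map-++; length-++; length-map)
open import Data.List.Relation.Unary.All as All using (All; []; _∷_)
open import Data.List.Relation.Unary.All.Properties using (¬Any⇒All¬)
open import Data.List.Relation.Unary.AllPairs using (AllPairs; []; _∷_)
open import Data.List.Relation.Unary.Any using (Any; here; there; any?)
open import Data.Nat.DivMod
  using (_/_; _%_; _mod_; m≥n⇒m/n>0; m%n≡m∸m/n*n; m≡m%n+[m/n]*n; m%n<n; m/n*n≤m)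
open import Data.Nat.Induction using (<-rec)
open import Data.Nat.ListAction using () renaming (sum to sumᴸ)
open import Data.Nat.ListAction.Properties using (sum-++)
open import Data.Nat.Logarithm using (⌊log₂⌋-mono-≤; ⌊log₂⌊n/2⌋⌋≡⌊log₂n⌋∸1; ⌊log₂[2^n]⌋≡n)
open import Data.Nat.Properties as ℕ hiding (_≟_; suc-injective)
open import Data.Nat.Solver using (module +-*-Solver)
open import Data.Rational.Base as ℚ using (ℚ; 0ℚ; 1ℚ; mkℚ; toℚᵘ)
import Data.Rational.Properties as ℚ
open import Data.Rational.Unnormalised.Base as ℚᵘ using (mkℚᵘ)
import Data.Rational.Unnormalised.Properties as ℚᵘ
open import Data.Sum.Base using (inj₁; inj₂)
open import Data.Vec.Base using (Vec; []; _∷_; lookup; _[_]≔_; here; there)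
open import Data.Vec.Properties
  using ([]=⇒lookup; lookup⇒[]=; []≔-updates; []≔-minimal; lookup∘update′)
open import Function.Base using (_∘_)
open import Function.Bundles using (mk⇔; Equivalence)
open import Level using (0ℓ)
open import Relation.Binary.Core using (Rel)
open import Relation.Binary.Definitions using (Decidable; Reflexive; Symmetric; tri<; tri≈; tri>)
open import Relation.Binary.PropositionalEquality hiding (J)
open import Relation.Nullary using (Dec; ¬_; yes; no; does; contradiction)
open import Relation.Nullary.Decidable using (_×-dec_; ¬?; decidable-stable; from-yes)

open import Algebra.Properties.Semiring.Sum +-*-semiring
  using (sum; sum-cong-≗; ∑-distrib-+; *-distribˡ-sum; sum-replicate-zero)
open +-*-Solver using (solve; _:+_; _:*_; _:=_; con)

-- A code with few agreements

^-distribʳ-* : ∀ o m n → (m * n) ^ o ≡ m ^ o * n ^ o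
^-distribʳ-* zero    m n = refl
^-distribʳ-* (suc o) m n =
  trans (cong (m * n *_) (^-distribʳ-* o m n)) ([m*n]*[o*p]≡[m*o]*[n*p] m n (m ^ o) (n ^ o))

-- A weight that factors over pairs sums to a product, so `∑7^agree` can be computed one letter at a
-- time.
sumᴸ-cartesianProductWith : ∀ {A B C : Set} {h : C → ℕ} (f : A → B → C) (g : A → ℕ) (k : B → ℕ) →
  (∀ x y → h (f x y) ≡ g x * k y) → ∀ xs ys →
  sumᴸ (map h (cartesianProductWith f xs ys)) ≡ sumᴸ (map g xs) * sumᴸ (map k ys)
sumᴸ-cartesianProductWith         f g k eq []       ys = refl
sumᴸ-cartesianProductWith {h = h} f g k eq (x ∷ xs) ys = begin
  sumᴸ (map h (map (f x) ys ++ cartesianProductWith f xs ys))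
    ≡⟨ cong sumᴸ (map-++ h (map (f x) ys) _) ⟩
  sumᴸ (map h (map (f x) ys) ++ map h (cartesianProductWith f xs ys))
    ≡⟨ sum-++ (map h (map (f x) ys)) _ ⟩
  sumᴸ (map h (map (f x) ys)) + sumᴸ (map h (cartesianProductWith f xs ys))
    ≡⟨ cong₂ _+_ (row ys) (sumᴸ-cartesianProductWith f g k eq xs ys) ⟩
  g x * sumᴸ (map k ys) + sumᴸ (map g xs) * sumᴸ (map k ys)
    ≡⟨ *-distribʳ-+ (sumᴸ (map k ys)) (g x) _ ⟨
  (g x + sumᴸ (map g xs)) * sumᴸ (map k ys) ∎
  where
  open ≡-Reasoning
  row : ∀ zs → sumᴸ (map h (map (f x) zs)) ≡ g x * sumᴸ (map k zs)
  row []       = sym (*-zeroʳ (g x))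
  row (z ∷ zs) = trans (cong₂ _+_ (eq x z) (row zs)) (sym (*-distribˡ-+ (g x) (k z) _))

length-cartesianProductWith : ∀ {A B C : Set} (f : A → B → C) xs ys →
  length (cartesianProductWith f xs ys) ≡ length xs * length ys
length-cartesianProductWith f []       ys = refl
length-cartesianProductWith f (x ∷ xs) ys =
  trans (length-++ (map (f x) ys))
        (cong₂ _+_ (length-map (f x) ys) (length-cartesianProductWith f xs ys))

sumᴸ-map-+ : ∀ {A : Set} (f g : A → ℕ) xs →
  sumᴸ (map (λ x → f x + g x) xs) ≡ sumᴸ (map f xs) + sumᴸ (map g xs)
sumᴸ-map-+ f g []       = refl
sumᴸ-map-+ f g (x ∷ xs) rewrite sumᴸ-map-+ f g xs =
  solve 4 (λ a b c d → (a :+ b) :+ (c :+ d) := (a :+ c) :+ (b :+ d)) refl (f x) (g x) _ _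

-- Greedy choice: an element joins the list only if it is related to none chosen so far. Reflexivity
-- lets a new member cover itself.
maximal-independent : ∀ {A : Set} {R : Rel A 0ℓ} → Decidable R → Reflexive R → ∀ xs →
  ∃ λ ys → AllPairs (λ x y → ¬ R x y) ys × All (λ x → Any (R x) ys) xs
maximal-independent R? R-refl []       = [] , [] , []
maximal-independent R? R-refl (x ∷ xs) with maximal-independent R? R-refl xs
... | ys , indep , cover with any? (R? x) ys
...   | yes x∼ys = ys , indep , x∼ys ∷ cover
...   | no  x≁ys = x ∷ ys , ¬Any⇒All¬ ys x≁ys ∷ indep , here R-refl ∷ All.map there cover

AllPairs-lookup : ∀ {A : Set} {R : Rel A 0ℓ} {xs} → Symmetric R → AllPairs R xs →
  ∀ {i j} → i ≢ j → R (List.lookup xs i) (List.lookup xs j)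
AllPairs-lookup s (x ∷ xs) {zero}  {zero}  i≢j = contradiction refl i≢j
AllPairs-lookup s (x ∷ xs) {zero}  {suc j} i≢j = All.lookup x (∈-lookup j)
AllPairs-lookup s (x ∷ xs) {suc i} {zero}  i≢j = s (All.lookup x (∈-lookup i))
AllPairs-lookup s (x ∷ xs) {suc i} {suc j} i≢j = AllPairs-lookup s xs (i≢j ∘ cong suc)

Word : ℕ → Set
Word m = Vec (Fin 8) m

δ : ∀ {q} → Fin q → Fin q → ℕ
δ a c = if does (a ≟ c) then 1 else 0

δ-refl : ∀ {q} (a : Fin q) → δ a a ≡ 1
δ-refl a with a ≟ a
... | yes _  = refl
... | no a≢a = contradiction refl a≢a

δ-≢ : ∀ {q} {a c : Fin q} → a ≢ c → δ a c ≡ 0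
δ-≢ {a = a} {c} a≢c with a ≟ c
... | yes a≡c = contradiction a≡c a≢c
... | no  _   = refl

δ-comm : ∀ {q} (a c : Fin q) → δ a c ≡ δ c a
δ-comm a c with a ≟ c
... | yes refl = sym (δ-refl a)
... | no  a≢c  = sym (δ-≢ (a≢c ∘ sym))

agree : ∀ {m} → Word m → Word m → ℕ
agree v w = sum λ i → δ (lookup v i) (lookup w i)

agree-comm : ∀ {m} (v w : Word m) → agree v w ≡ agree w v
agree-comm v w = sum-cong-≗ λ i → δ-comm (lookup v i) (lookup w i)

agree-refl : ∀ {m} (v : Word m) → agree v v ≡ m
agree-refl []      = refl
agree-refl (a ∷ v) = cong₂ _+_ (δ-refl a) (agree-refl v)

words : ∀ m → List (Word m)
words zero    = [] ∷ []
words (suc m) = cartesianProductWith _∷_ (allFin 8) (words m)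

length-words : ∀ m → length (words m) ≡ 8 ^ m
length-words zero    = refl
length-words (suc m) =
  trans (length-cartesianProductWith _∷_ (allFin 8) (words m)) (cong (8 *_) (length-words m))

-- The sum factors over positions: the one agreeing letter weighs 7 and the seven others weigh 1, so
-- each position contributes 14.
∑7^agree : ∀ {m} (w : Word m) → sumᴸ (map (λ v → 7 ^ agree v w) (words m)) ≡ 14 ^ m
∑7^agree         []      = refl
∑7^agree {suc m} (c ∷ w) =
  trans (sumᴸ-cartesianProductWith _∷_ (λ a → 7 ^ δ a c) (λ v → 7 ^ agree v w)
           (λ a v → ^-distribˡ-+-* 7 (δ a c) (agree v w)) (allFin 8) (words m))
        (cong₂ _*_ (letter c) (∑7^agree w))
  where
  letter : ∀ c → sumᴸ (map (λ a → 7 ^ δ a c) (allFin 8)) ≡ 14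
  letter = from-yes (all? λ c → sumᴸ (map (λ a → 7 ^ δ a c) (allFin 8)) ℕ.≟ 14)

-- Double counting of the pairs v ∈ words m, w ∈ ws with weight 7 ^ agree v w.
covering-bound : ∀ {m} d (ws : List (Word m)) →
  All (λ v → Any (λ w → d ≤ agree v w) ws) (words m) →
  8 ^ m * 7 ^ d ≤ length ws * 14 ^ m
covering-bound {m} d ws cover = begin
  8 ^ m * 7 ^ d                     ≡⟨ cong (_* 7 ^ d) (length-words m) ⟨
  length (words m) * 7 ^ d          ≤⟨ lower cover ⟩
  sumᴸ (map (weight ws) (words m))  ≡⟨ total ws ⟩
  length ws * 14 ^ m                ∎
  where
  open ≤-Reasoning
  weight : List (Word m) → Word m → ℕ
  weight ws v = sumᴸ (map (λ w → 7 ^ agree v w) ws)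

  weight≥ : ∀ v {ws} → Any (λ w → d ≤ agree v w) ws → 7 ^ d ≤ weight ws v
  weight≥ v {w ∷ ws} (here  d≤) =
    ≤-trans (^-monoʳ-≤ 7 d≤) (m≤m+n (7 ^ agree v w) (weight ws v))
  weight≥ v {w ∷ ws} (there p)  = ≤-trans (weight≥ v p) (m≤n+m (weight ws v) (7 ^ agree v w))

  lower : ∀ {vs} → All (λ v → Any (λ w → d ≤ agree v w) ws) vs →
    length vs * 7 ^ d ≤ sumᴸ (map (weight ws) vs)
  lower         []       = z≤n
  lower {v ∷ _} (p ∷ ps) = +-mono-≤ (weight≥ v p) (lower ps)

  total : ∀ ws → sumᴸ (map (weight ws) (words m)) ≡ length ws * 14 ^ m
  total []       = zeros (words m)
    where
    zeros : ∀ (vs : List (Word m)) → sumᴸ (map (weight []) vs) ≡ 0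
    zeros []       = refl
    zeros (_ ∷ vs) = zeros vs
  total (w ∷ ws) = trans (sumᴸ-map-+ (λ v → 7 ^ agree v w) (weight ws) (words m))
                         (cong₂ _+_ (∑7^agree w) (total ws))

-- Greedily chosen words cover, so covering-bound applies with d = b + 1; the base 7
-- of the weights minimises (z + 7)² / z, making it 28 < 64 / 2.
code-exists : ∀ b → ∃ λ t → 2 ^ b ≤ t ×
  Σ (Fin t → Word (2 * b)) λ w → ∀ {i j} → i ≢ j → agree (w i) (w j) ≤ b
-- Reflexivity of the covering relation needs b < 2 b, so b = 0 is served by the single empty word.
code-exists zero = 1 , ≤-refl , (λ _ → []) , λ { {zero} {zero} i≢j → contradiction refl i≢j }
code-exists b@(suc _)
  with ws , indep , cover ← maximal-independent (λ v w → suc b ≤? agree v w)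
         (λ {v} → subst (b <_) (sym (agree-refl v)) (m<m+n b (s≤s z≤n)))
         (words (2 * b))
  = length ws , ≮⇒≥ short , List.lookup ws ,
    λ i≢j → ≮⇒≥ (AllPairs-lookup (λ {v} {w} v≁w → v≁w ∘ subst (b <_) (agree-comm w v)) indep i≢j)
  where
  open ≤-Reasoning
  short : length ws ≮ 2 ^ b
  short ws<2^b = <-irrefl refl (begin-strict
    length ws * 14 ^ (2 * b)  ≡⟨ cong (length ws *_) (^-*-assoc 14 2 b) ⟨
    length ws * 196 ^ b       <⟨ *-monoˡ-< (196 ^ b) {{m^n≢0 196 b}} ws<2^b ⟩
    2 ^ b * 196 ^ b           ≡⟨ ^-distribʳ-* b 2 196 ⟨
    392 ^ b                   ≤⟨ ^-monoˡ-≤ b (≤ᵇ⇒≤ 392 448 _) ⟩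
    448 ^ b                   ≡⟨ ^-distribʳ-* b 64 7 ⟩
    64 ^ b * 7 ^ b            ≤⟨ *-monoʳ-≤ (64 ^ b) (^-monoʳ-≤ 7 (n≤1+n b)) ⟩
    64 ^ b * 7 ^ suc b        ≡⟨ cong (_* 7 ^ suc b) (^-*-assoc 8 2 b) ⟩
    8 ^ (2 * b) * 7 ^ suc b   ≤⟨ covering-bound (suc b) ws cover ⟩
    length ws * 14 ^ (2 * b)  ∎)

-- From vertex labellings to cluster packings

∣p[x]≔inside∣ : ∀ {n} (p : Subset n) x → x ∉ p → ∣ p [ x ]≔ inside ∣ ≡ suc ∣ p ∣
∣p[x]≔inside∣ (true  ∷ p) zero    x∉p = contradiction here x∉p
∣p[x]≔inside∣ (false ∷ p) zero    x∉p = refl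
∣p[x]≔inside∣ (true  ∷ p) (suc x) x∉p = cong suc (∣p[x]≔inside∣ p x (x∉p ∘ there))
∣p[x]≔inside∣ (false ∷ p) (suc x) x∉p = ∣p[x]≔inside∣ p x (x∉p ∘ there)

image : ∀ {k n} → (Fin k → Fin n) → Subset n
image {zero}  f = ∅
image {suc k} f = image (f ∘ suc) [ f zero ]≔ inside

∈-image⁺ : ∀ {k n} (f : Fin k → Fin n) j → f j ∈ image f
∈-image⁺ f zero    = []≔-updates (image (f ∘ suc)) (f zero)
∈-image⁺ f (suc j) with f (suc j) ≟ f zero
... | yes eq = subst (_∈ image f) (sym eq) (∈-image⁺ f zero)
... | no neq = []≔-minimal (image (f ∘ suc)) (f (suc j)) (f zero) neq (∈-image⁺ (f ∘ suc) j)

∈-image⁻ : ∀ {k n} (f : Fin k → Fin n) {v} → v ∈ image f → ∃ λ j → f j ≡ v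
∈-image⁻ {zero}  f v∈ = contradiction v∈ ∉⊥
∈-image⁻ {suc k} f {v} v∈ with v ≟ f zero
... | yes eq = zero , sym eq
... | no neq with j , eq ← ∈-image⁻ (f ∘ suc) (lookup⇒[]= v (image (f ∘ suc))
                   (trans (sym (lookup∘update′ neq (image (f ∘ suc)) inside)) ([]=⇒lookup v∈)))
    = suc j , eq

∣image∣ : ∀ {k n} (f : Fin k → Fin n) → (∀ {i j} → f i ≡ f j → i ≡ j) → ∣ image f ∣ ≡ k
∣image∣ {zero}  {n} f inj = ∣⊥∣≡0 n
∣image∣ {suc k} f inj =
  trans (∣p[x]≔inside∣ _ (f zero) fresh) (cong suc (∣image∣ (f ∘ suc) (suc-injective ∘ inj)))
  where
  fresh : f zero ∉ image (f ∘ suc)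
  fresh p with ∈-image⁻ (f ∘ suc) p
  ... | j , eq with () ← inj eq

-- τ, σ number the clusters, i and a the cliques of a cluster, and j the parts, each
-- clique having one vertex in each part.  The field edge-unique says that an edge
-- of σ with both ends in the cluster τ forces τ ≡ σ; it yields both that clusters
-- are induced and that they partition the edges.
record Design (n r t k : ℕ) : Set where
  field
    vertex        : Fin t → Fin r → Fin k → Fin n
    part-unique   : ∀ {τ i j σ i′ j′} → vertex τ i j ≡ vertex σ i′ j′ → j ≡ j′
    clique-unique : ∀ {τ i i′ j} → vertex τ i j ≡ vertex τ i′ j → i ≡ i′
    edge-unique   : ∀ {τ i i′ σ a j j′} → j ≢ j′ →
                    vertex τ i j ≡ vertex σ a j → vertex τ i′ j′ ≡ vertex σ a j′ → τ ≡ σ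
    separated     : ∀ {τ σ} → (∀ i j → ∃₂ λ i′ j′ → vertex τ i′ j′ ≡ vertex σ i j) → τ ≡ σ

-- The graph is the union of the clusters, coloured by parts; a clique meets each part once, so the
-- ends of an edge differ in colour.
packing : ∀ {n r t k} → Design n r t k → 1 ≤ r → 1 ≤ t → 1 ≤ k → Σ (Graph n) (IsClusterPacking r t k)
packing {n} {r} {t} {suc k} D r≥1 t≥1 k≥1 = G , record
  { r≥1       = r≥1
  ; t≥1       = t≥1
  ; k≥1       = k≥1
  ; cluster   = cluster
  ; induced   = λ τ u∈ v∈ → mk⇔ (inducedEdge u∈ v∈) (τ ,_)
  ; partition = λ { (τ , e) → τ , e , λ e′ → sameCluster e e′ }
  -- The vertex sets alone tell clusters apart, which also settles k = 1, where there are no edges.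
  ; distinct  = λ (verts , _) → separated λ i j →
      let a , v∈ = Equivalence.from (verts _) (i , ∈-image⁺ (vertex _ i) j)
      in  a , ∈-image⁻ (vertex _ a) v∈
  ; colorable = colour , λ { (τ , u≢v , i , u∈ , v∈) c≡ →
      let j , p = ∈-image⁻ (vertex τ i) u∈
          l , q = ∈-image⁻ (vertex τ i) v∈
      in  u≢v (trans (sym p) (trans (cong (vertex τ i)
            (trans (sym (colour-vertex p)) (trans c≡ (colour-vertex q)))) q)) }
  }
  where
  open Design D

  cluster : Fin t → Cluster n r (suc k)
  cluster τ = record
    { clique   = λ i → image (vertex τ i)
    ; order    = λ i → ∣image∣ (vertex τ i) part-unique
    ; disjoint = λ {i} {j} p q → disjoint (∈-image⁻ (vertex τ i) p) (∈-image⁻ (vertex τ j) q)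
    }
    where
    disjoint : ∀ {i i′ v} → (∃ λ j → vertex τ i j ≡ v) → (∃ λ j → vertex τ i′ j ≡ v) → i ≡ i′
    disjoint (j , p) (j′ , q) with refl ← part-unique (trans p (sym q)) = clique-unique (trans p (sym q))

  Edge : Fin t → Fin n → Fin n → Set
  Edge τ = Cluster.Edge (cluster τ)

  Edge-sym : ∀ τ {u v} → Edge τ u v → Edge τ v u
  Edge-sym τ (u≢v , i , u∈ , v∈) = u≢v ∘ sym , i , v∈ , u∈

  G : Graph n
  G = record
    { _~_   = λ u v → ∃ λ τ → Edge τ u v
    ; ~-sym = λ (τ , e) → τ , Edge-sym τ e
    ; ~-irr = λ u≡v (_ , u≢v , _) → u≢v u≡v
    ; _~?_  = λ u v → anyFin? λ τ → ¬? (u ≟ v) ×-dec anyFin? λ i →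
                u ∈? image (vertex τ i) ×-dec v ∈? image (vertex τ i)
    }

  -- The two ends may lie in different cliques of `τ`, as inducedness requires; taking one clique
  -- for both gives uniqueness in the partition.
  sameCluster′ : ∀ {τ σ u v} → Cluster.Vertex (cluster τ) u → Cluster.Vertex (cluster τ) v →
    Edge σ u v → τ ≡ σ
  sameCluster′ {τ} {σ} (i , u∈) (i′ , v∈) (u≢v , a , u∈′ , v∈′)
    with j  , refl ← ∈-image⁻ (vertex σ a) u∈′
       | j′ , refl ← ∈-image⁻ (vertex σ a) v∈′
       | l  , p ← ∈-image⁻ (vertex τ i) u∈
       | l′ , q ← ∈-image⁻ (vertex τ i′) v∈
    with refl ← part-unique p | refl ← part-unique q
    = edge-unique (u≢v ∘ cong (vertex σ a)) p q

  sameCluster : ∀ {τ σ u v} → Edge τ u v → Edge σ u v → τ ≡ σ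
  sameCluster (_ , i , u∈ , v∈) = sameCluster′ (i , u∈) (i , v∈)

  inducedEdge : ∀ {τ u v} → Cluster.Vertex (cluster τ) u → Cluster.Vertex (cluster τ) v →
    (∃ λ σ → Edge σ u v) → Edge τ u v
  inducedEdge u∈ v∈ (σ , e) with refl ← sameCluster′ u∈ v∈ e = e

  InPart : Fin n → Fin (suc k) → Set
  InPart v j = ∃₂ λ τ i → vertex τ i j ≡ v

  inPart? : ∀ v → Dec (∃ (InPart v))
  inPart? v = anyFin? λ j → anyFin? λ τ → anyFin? λ i → vertex τ i j ≟ v

  colour : Fin n → Fin (suc k)
  colour v with inPart? v
  ... | yes (j , _) = j
  -- A vertex in no clique is isolated, so any colour serves.
  ... | no  _       = zero

  colour-vertex : ∀ {τ i j v} → vertex τ i j ≡ v → colour v ≡ j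
  colour-vertex {v = v} p with inPart? v
  ... | yes (j , τ , i , q) = part-unique (trans q (sym p))
  ... | no  none            = contradiction (_ , _ , _ , p) none

-- Congruences and the clusters of a code

infix 4 _≈_[mod_]
-- Multiples of `p` may be added on both sides, which expresses congruence in ℕ symmetrically and
-- without subtraction.
record _≈_[mod_] (a c p : ℕ) : Set where
  constructor wind
  field
    left right : ℕ
    balanced   : a + left * p ≡ c + right * p

mod-reflexive : ∀ {p a c} → a ≡ c → a ≈ c [mod p ]
mod-reflexive refl = wind 0 0 refl

mod-sym : ∀ {p a c} → a ≈ c [mod p ] → c ≈ a [mod p ]
mod-sym (wind r s eq) = wind s r (sym eq)

mod-+ : ∀ {p a c a′ c′} → a ≈ c [mod p ] → a′ ≈ c′ [mod p ] → a + a′ ≈ c + c′ [mod p ]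
mod-+ {p} {a} {c} {a′} {c′} (wind r s eq) (wind r′ s′ eq′) = wind (r + r′) (s + s′)
  (trans (regroup a a′ r r′) (trans (cong₂ _+_ eq eq′) (sym (regroup c c′ s s′))))
  where
  regroup : ∀ a a′ r r′ → a + a′ + (r + r′) * p ≡ (a + r * p) + (a′ + r′ * p)
  regroup = solve 5 (λ p a a′ r r′ → a :+ a′ :+ (r :+ r′) :* p := (a :+ r :* p) :+ (a′ :+ r′ :* p)) refl p

mod-cancelʳ : ∀ {p a c} d → a + d ≈ c + d [mod p ] → a ≈ c [mod p ]
mod-cancelʳ {p} {a} {c} d (wind r s eq) = wind r s
  (+-cancelʳ-≡ d _ _ (trans (swap a r) (trans eq (sym (swap c s)))))
  where
  swap : ∀ a r → a + r * p + d ≡ a + d + r * p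
  swap = solve 4 (λ p d a r → a :+ r :* p :+ d := a :+ d :+ r :* p) refl p d

-- Adding the two congruences and cancelling the middle term avoids handling the windings.
mod-trans : ∀ {p a c d} → a ≈ c [mod p ] → c ≈ d [mod p ] → a ≈ d [mod p ]
mod-trans {p} {a} {c} {d} a≈c c≈d =
  mod-cancelʳ c (subst (a + c ≈_[mod p ]) (+-comm c d) (mod-+ a≈c c≈d))

mod-sum : ∀ {p n} {f g : Fin n → ℕ} → (∀ i → f i ≈ g i [mod p ]) → sum f ≈ sum g [mod p ]
mod-sum {n = zero}  f≈g = mod-reflexive refl
mod-sum {n = suc n} f≈g = mod-+ (f≈g zero) (mod-sum (f≈g ∘ suc))

toℕ-mod : ∀ {p} .{{_ : NonZero p}} a → toℕ (a mod p) ≈ a [mod p ]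
toℕ-mod {p} a = wind (a / p) 0 (begin
  toℕ (a mod p) + a / p * p  ≡⟨ cong (_+ a / p * p) (toℕ-fromℕ< (m%n<n a p)) ⟩
  a % p + a / p * p          ≡⟨ m≡m%n+[m/n]*n a p ⟨
  a                          ≡⟨ +-identityʳ a ⟨
  a + 0                      ∎)
  where open ≡-Reasoning

mod-≡ : ∀ {p} .{{_ : NonZero p}} a c → a mod p ≡ c mod p → a ≈ c [mod p ]
mod-≡ a c eq = mod-trans (mod-sym (toℕ-mod a)) (mod-trans (mod-reflexive (cong toℕ eq)) (toℕ-mod c))

-- Compare the windings: for `r ≤ s` the right side is larger, otherwise the extra `p` makes the
-- left side larger.
mod-≢ : ∀ {p a c} → a < c → c < a + p → ¬ a ≈ c [mod p ]
mod-≢ {p} {a} {c} a<c c<a+p (wind r s eq) with r ≤? s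
... | yes r≤s = <⇒≢ (+-mono-<-≤ a<c (*-monoˡ-≤ p r≤s)) eq
... | no  r≰s = <⇒≢ (begin-strict
  c + s * p        <⟨ +-monoˡ-< (s * p) c<a+p ⟩
  a + p + s * p    ≡⟨ +-assoc a p (s * p) ⟩
  a + suc s * p    ≤⟨ +-monoʳ-≤ a (*-monoˡ-≤ p (≰⇒> r≰s)) ⟩
  a + r * p        ∎) (sym eq)
  where open ≤-Reasoning

mod-<-≡ : ∀ {p a c} → a < p → c < p → a ≈ c [mod p ] → a ≡ c
mod-<-≡ {p} {a} {c} a<p c<p a≈c with <-cmp a c
... | tri< a<c _ _ = contradiction a≈c (mod-≢ a<c (<-≤-trans c<p (m≤n+m p a)))
... | tri≈ _ a≡c _ = a≡c
... | tri> _ _ c<a = contradiction (mod-sym a≈c) (mod-≢ c<a (<-≤-trans a<p (m≤n+m p c)))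

-- Functions and pairs encoded in `Fin`

funToFin-cong : ∀ {m n} {f g : Fin m → Fin n} → (∀ i → f i ≡ g i) → funToFin f ≡ funToFin g
funToFin-cong {zero}  f≗g = refl
funToFin-cong {suc m} f≗g = cong₂ combine (f≗g zero) (funToFin-cong (f≗g ∘ suc))

finToFun-injective : ∀ m n {x y : Fin (n ^ m)} → (∀ i → finToFun {n} {m} x i ≡ finToFun y i) → x ≡ y
finToFun-injective m n {x} {y} x≗y =
  trans (sym (funToFin-finToFin {m} {n} x)) (trans (funToFin-cong {m} {n} x≗y) (funToFin-finToFin {m} {n} y))

funToFin-injective : ∀ {m n} {f g : Fin m → Fin n} → funToFin f ≡ funToFin g → ∀ i → f i ≡ g i
funToFin-injective {f = f} {g} eq i =
  trans (sym (finToFun-funToFin f i)) (trans (cong (λ x → finToFun x i) eq) (finToFun-funToFin g i))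

remQuot-injective : ∀ {m} n {x y : Fin (m * n)} → remQuot {m} n x ≡ remQuot n y → x ≡ y
remQuot-injective {m} n {x} {y} eq =
  trans (sym (combine-remQuot {m} n x)) (trans (cong (uncurry combine) eq) (combine-remQuot {m} n y))

-- Sums of coordinates along a word

sum-δ : ∀ {n} (i : Fin n) → sum (λ l → δ l i) ≡ 1
sum-δ {suc n} zero    = cong suc (sum-replicate-zero n)
sum-δ {suc n} (suc i) = sum-δ i

differ : ∀ {m} (v w : Word m) → agree v w < m → ∃ λ i → lookup v i ≢ lookup w i
differ {m} v w agree<m with anyFin? (λ i → ¬? (lookup v i ≟ lookup w i))
... | yes d   = d
... | no none = contradiction
  (trans (sum-cong-≗ λ i → cong (δ (lookup v i))
           (sym (decidable-stable (lookup v i ≟ lookup w i) λ ne → none (i , ne))))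
         (agree-refl v))
  (<⇒≢ agree<m)

-- The sum h_v of the construction: coordinates are indexed by pairs of a place and a letter, and
-- the graph of `v` picks one per place.
∑along : ∀ {m} → Word m → (Fin (m * 8) → ℕ) → ℕ
∑along v x = sum λ i → x (combine i (lookup v i))

indicator : ∀ {m} → Word m → Fin (m * 8) → ℕ
indicator w e = let i , a = remQuot 8 e in δ a (lookup w i)

-- The graphs of `v` and `w` share `agree v w` points, and each of them gains `j`.
∑along-shift : ∀ {m} (v w : Word m) x j →
  ∑along v (λ e → x e + j * indicator w e) ≡ ∑along v x + j * agree v w
∑along-shift v w x j = begin
  sum (λ i → x (at i) + j * indicator w (at i))
    ≡⟨ ∑-distrib-+ (λ i → x (at i)) (λ i → j * indicator w (at i)) ⟩
  ∑along v x + sum (λ i → j * indicator w (at i))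
    ≡⟨ cong (λ s → ∑along v x + s) (*-distribˡ-sum j (λ i → indicator w (at i))) ⟨
  ∑along v x + j * sum (λ i → indicator w (at i))
    ≡⟨ cong (λ s → ∑along v x + j * s) (sum-cong-≗ λ i →
         cong (λ (l , a) → δ a (lookup w l)) (remQuot-combine i (lookup v i))) ⟩
  ∑along v x + j * agree v w ∎
  where
  open ≡-Reasoning
  at : ∀ i → Fin _
  at i = combine i (lookup v i)

∑along-point : ∀ {m} (v w : Word m) i →
  ∑along v (λ e → δ e (combine i (lookup w i))) ≡ δ (lookup v i) (lookup w i)
∑along-point {m} v w i with lookup v i ≟ lookup w i
... | yes eq = trans (sum-cong-≗ diagonal) (sum-δ i)
  where
  diagonal : ∀ l → δ (combine l (lookup v l)) (combine i (lookup w i)) ≡ δ l i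
  diagonal l with l ≟ i
  ... | yes refl = trans (cong (λ a → δ (combine l a) (combine l (lookup w l))) eq)
                         (δ-refl (combine l (lookup w l)))
  ... | no  l≢i  = δ-≢ (l≢i ∘ proj₁ ∘ combine-injective l _ i _)
... | no neq = trans (sum-cong-≗ offDiagonal) (sum-replicate-zero m)
  where
  offDiagonal : ∀ l → δ (combine l (lookup v l)) (combine i (lookup w i)) ≡ 0
  offDiagonal l = δ-≢ λ eq → neq (helper (combine-injective l _ i _ eq))
    where
    helper : l ≡ i × lookup v l ≡ lookup w i → lookup v i ≡ lookup w i
    helper (refl , eq) = eq

-- The sizes m and p are variables with equations, as the vertex type would unfold
-- over the products 2 * b and k * m.
torusDesign : ∀ {t n} b k M m p → m ≡ 2 * b → p ≡ k * m → 1 ≤ b → 1 ≤ k → 1 ≤ M →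
  (w : Fin t → Word m) → (∀ {τ σ} → τ ≢ σ → agree (w τ) (w σ) ≤ b) →
  M * (k * (p * p ^ (m * 8))) ≤ n → Design n (M * (p ^ (m * 8) * b)) t k
torusDesign {t} {n} b k M m p m≡2b p≡km 1≤b 1≤k 1≤M w sparse fits = record
  { vertex        = vertex
  ; part-unique   = λ {τ} {i} {j} {σ} {i′} {j′} eq → same-part τ σ i i′ j j′ eq
  ; clique-unique = λ {τ} {i} {i′} {j} → clique-unique τ i i′ j
  ; edge-unique   = λ {τ} {i} {i′} {σ} {a} {j} {j′} → edge-unique τ σ i i′ a j j′
  ; separated     = λ {τ} {σ} → separated τ σ
  }
  where
  P = p ^ (m * 8)
  r = M * (P * b)

  m≤p : m ≤ p
  m≤p = subst (m ≤_) (sym p≡km) (m≤n*m m k {{>-nonZero 1≤k}})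

  b<m : b < m
  b<m = subst (b <_) (sym m≡2b) (m<m+n b (subst (1 ≤_) (sym (+-identityʳ b)) 1≤b))

  b<p : b < p
  b<p = <-≤-trans b<m m≤p

  instance
    p-nonZero : NonZero p
    p-nonZero = >-nonZero (≤-<-trans z≤n b<p)

  -- A clique is numbered by its copy of the graph, its base point x and its level u < b.
  copy : Fin r → Fin M
  copy i = proj₁ (remQuot {M} (P * b) i)

  base : Fin r → Fin P
  base i = proj₁ (remQuot {P} b (proj₂ (remQuot {M} (P * b) i)))

  level : Fin r → Fin b
  level i = proj₂ (remQuot {P} b (proj₂ (remQuot {M} (P * b) i)))

  index-injective : ∀ {i i′} → copy i ≡ copy i′ → base i ≡ base i′ → level i ≡ level i′ → i ≡ i′
  index-injective c x u = remQuot-injective {M} (P * b)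
    (cong₂ _,_ c (remQuot-injective {P} b (cong₂ _,_ x u)))

  coord : Fin P → Fin (m * 8) → ℕ
  coord x e = toℕ (finToFun {p} {m * 8} x e)

  height : Fin t → Fin r → ℕ
  height τ i = ∑along (w τ) (coord (base i))

  moved : Fin t → Fin r → Fin k → Fin (m * 8) → ℕ
  moved τ i j e = coord (base i) e + toℕ j * indicator (w τ) e

  vertex : Fin t → Fin r → Fin k → Fin n
  vertex τ i j = inject≤ (combine (copy i) (combine j (combine
    ((height τ i + toℕ (level i)) mod p) (funToFin (λ e → moved τ i j e mod p))))) fits

  decode : ∀ τ σ i i′ j j′ → vertex τ i j ≡ vertex σ i′ j′ →
    copy i ≡ copy i′ × j ≡ j′ ×
    height τ i + toℕ (level i) ≈ height σ i′ + toℕ (level i′) [mod p ] ×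
    (∀ e → moved τ i j e ≈ moved σ i′ j′ e [mod p ])
  decode τ σ i i′ j₁ j′ eq =
    let c , eq₁ = combine-injective (copy i) _ (copy i′) _ (inject≤-injective fits fits _ _ eq)
        j , eq₂ = combine-injective j₁ _ j′ _ eq₁
        y , eq₃ = combine-injective (Y mod p) _ (Y′ mod p) _ eq₂
    in  c , j , mod-≡ Y Y′ y ,
        λ e → mod-≡ (moved τ i j₁ e) (moved σ i′ j′ e) (funToFin-injective {m * 8} {p} eq₃ e)
    where
    Y  = height τ i + toℕ (level i)
    Y′ = height σ i′ + toℕ (level i′)

  same-part : ∀ τ σ i i′ j j′ → vertex τ i j ≡ vertex σ i′ j′ → j ≡ j′
  same-part τ σ i i′ j j′ eq = proj₁ (proj₂ (decode τ σ i i′ j j′ eq))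

  same-height : ∀ τ σ i i′ j j′ → vertex τ i j ≡ vertex σ i′ j′ →
    height τ i + toℕ (level i) ≈ height σ i′ + toℕ (level i′) [mod p ]
  same-height τ σ i i′ j j′ eq = proj₁ (proj₂ (proj₂ (decode τ σ i i′ j j′ eq)))

  same-moved : ∀ τ σ i i′ j j′ → vertex τ i j ≡ vertex σ i′ j′ →
    ∀ e → moved τ i j e ≈ moved σ i′ j′ e [mod p ]
  same-moved τ σ i i′ j j′ eq = proj₂ (proj₂ (proj₂ (decode τ σ i i′ j j′ eq)))

  clique-unique : ∀ τ i i′ j → vertex τ i j ≡ vertex τ i′ j → i ≡ i′
  clique-unique τ i i′ j eq =
    index-injective (proj₁ (decode τ τ i i′ j j eq)) base≡
      (toℕ-injective (mod-<-≡ (level<p i) (level<p i′) (mod-cancelʳ (height τ i) level≈)))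
    where
    level<p : ∀ i → toℕ (level i) < p
    level<p i = <-trans (toℕ<n (level i)) b<p

    -- In the same part of the same cluster the shifts j 1_w coincide and cancel.
    base≡ : base i ≡ base i′
    base≡ = finToFun-injective (m * 8) p λ e →
      toℕ-injective (mod-<-≡
        (toℕ<n (finToFun {p} {m * 8} (base i) e)) (toℕ<n (finToFun {p} {m * 8} (base i′) e))
        (mod-cancelʳ (toℕ j * indicator (w τ) e) (same-moved τ τ i i′ j j eq e)))

    level≈ : toℕ (level i) + height τ i ≈ toℕ (level i′) + height τ i [mod p ]
    level≈ = subst₂ _≈_[mod p ] (+-comm (height τ i) (toℕ (level i)))
      (trans (cong (λ z → ∑along (w τ) (coord z) + toℕ (level i′)) (sym base≡))
             (+-comm (height τ i) (toℕ (level i′))))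
      (same-height τ τ i i′ j j eq)

  -- Sum the coordinates of the common vertex over the graph of `w τ`: seen from `τ` they moved by
  -- `m` per part, seen from `σ` only by the agreement.
  along-moved : ∀ τ σ i a j → vertex τ i j ≡ vertex σ a j →
    height τ i + toℕ j * m ≈ ∑along (w τ) (coord (base a)) + toℕ j * agree (w τ) (w σ) [mod p ]
  along-moved τ σ i a j eq =
    subst₂ _≈_[mod p ]
      (trans (∑along-shift (w τ) (w τ) (coord (base i)) (toℕ j))
             (cong (λ s → height τ i + toℕ j * s) (agree-refl (w τ))))
      (∑along-shift (w τ) (w σ) (coord (base a)) (toℕ j))
      (mod-sum λ l → same-moved τ σ i a j j eq (combine l (lookup (w τ) l)))

  -- In the notation below, the two ends of the edge give u + D m ≈ u′ + D c, where
  -- D is the number of parts the edge crosses, m = 2b and c ≤ b.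
  no-foreign-edge : ∀ τ σ i i′ a j j′ → τ ≢ σ → toℕ j < toℕ j′ →
    vertex τ i j ≡ vertex σ a j → ¬ vertex τ i′ j′ ≡ vertex σ a j′
  no-foreign-edge τ σ i i′ a j j′ τ≢σ j<j′ eq eq′ = mod-≢ below above
    (mod-sym (mod-cancelʳ (A + A′ + Z + J * m + J * c) (subst₂ _≈_[mod p ]
      (trans (cong (λ J′ → A + u + ((A′ + J′ * m) + (Z + J * c))) J′≡)
        (solve 8 (λ A u A′ J D m Z c → A :+ u :+ ((A′ :+ (J :+ D) :* m) :+ (Z :+ J :* c))
          := u :+ D :* m :+ (A :+ A′ :+ Z :+ J :* m :+ J :* c)) refl A u A′ J D m Z c))
      (trans (cong (λ J′ → A′ + u′ + ((Z + J′ * c) + (A + J * m))) J′≡)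
        (solve 8 (λ A u′ A′ J D m Z c → A′ :+ u′ :+ ((Z :+ (J :+ D) :* c) :+ (A :+ J :* m))
          := u′ :+ D :* c :+ (A :+ A′ :+ Z :+ J :* m :+ J :* c)) refl A u′ A′ J D m Z c))
      -- The value y is constant along the clique `a` of `σ`, which equates A + u with A′ + u′
      -- modulo p; the two instances of `along-moved` bring in D m and D c.
      (mod-+ (mod-trans (same-height τ σ i a j j eq)
                        (mod-sym (same-height τ σ i′ a j′ j′ eq′)))
        (mod-+ (along-moved τ σ i′ a j′ eq′) (mod-sym (along-moved τ σ i a j eq)))))))
    where
    A = height τ i
    A′ = height τ i′
    Z = ∑along (w τ) (coord (base a))
    u = toℕ (level i)
    u′ = toℕ (level i′)
    c = agree (w τ) (w σ)
    J = toℕ j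
    D = toℕ j′ ∸ J
    J′≡ : toℕ j′ ≡ J + D
    J′≡ = sym (m+[n∸m]≡n (<⇒≤ j<j′))
    open ≤-Reasoning
    -- D m is twice D b: one half bounds D c and, as D ≥ 1, the other exceeds u′.
    below : u′ + D * c < u + D * m
    below = begin-strict
      u′ + D * c     <⟨ +-mono-<-≤ (toℕ<n (level i′)) (*-monoʳ-≤ D (sparse τ≢σ)) ⟩
      b + D * b      ≤⟨ +-monoˡ-≤ (D * b) (m≤n*m b D {{>-nonZero (m<n⇒0<n∸m j<j′)}}) ⟩
      D * b + D * b  ≡⟨ solve 2 (λ D b → D :* b :+ D :* b := D :* (con 2 :* b)) refl D b ⟩
      D * (2 * b)    ≡⟨ cong (D *_) m≡2b ⟨
      D * m          ≤⟨ m≤n+m (D * m) u ⟩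
      u + D * m      ∎
    -- There is no wrapping round ℤ_p: D ≤ k - 1 and u < m keep u + D m below k m = p.
    above : u + D * m < u′ + D * c + p
    above = begin-strict
      u + D * m       <⟨ +-monoˡ-< (D * m) (<-trans (toℕ<n (level i)) b<m) ⟩
      suc D * m       ≤⟨ *-monoˡ-≤ m (≤-<-trans (m∸n≤m (toℕ j′) J) (toℕ<n j′)) ⟩
      k * m           ≡⟨ p≡km ⟨
      p               ≤⟨ m≤n+m p (u′ + D * c) ⟩
      u′ + D * c + p  ∎

  edge-unique : ∀ τ σ i i′ a j j′ → j ≢ j′ →
    vertex τ i j ≡ vertex σ a j → vertex τ i′ j′ ≡ vertex σ a j′ → τ ≡ σ
  edge-unique τ σ i i′ a j j′ j≢j′ eq eq′ with τ ≟ σ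
  ... | yes τ≡σ = τ≡σ
  ... | no  τ≢σ with <-cmp (toℕ j) (toℕ j′)
  ...   | tri< j<j′ _ _ = contradiction eq′ (no-foreign-edge τ σ i i′ a j j′ τ≢σ j<j′ eq)
  ...   | tri≈ _ j≡j′ _ = contradiction (toℕ-injective j≡j′) j≢j′
  ...   | tri> _ _ j′<j = contradiction eq (no-foreign-edge τ σ i′ i a j′ j τ≢σ j′<j eq′)

  -- The vertex b · 1_(l , w σ l) with y = b lies in σ, but has height 0 along τ.
  clusters-differ : ∀ τ σ l → lookup (w τ) l ≢ lookup (w σ) l →
    ¬ (∀ i j → ∃₂ λ i′ j′ → vertex τ i′ j′ ≡ vertex σ i j)
  clusters-differ τ σ l apart covered =
    -- Lying in `τ` would force a level congruent to b, but levels are below b and b < p.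
    mod-≢ (toℕ<n (level i′)) (<-≤-trans b<p (m≤n+m p (toℕ (level i′)))) u′≡b
    where
    x₀ : Fin P
    x₀ = funToFin (λ e → (b * δ e (combine l (lookup (w σ) l))) mod p)
    j₀ : Fin k
    j₀ = fromℕ< 1≤k
    i₀ : Fin r
    i₀ = combine (fromℕ< 1≤M) (combine x₀ (fromℕ< 1≤b))
    i′ = proj₁ (covered i₀ j₀)
    j′ = proj₁ (proj₂ (covered i₀ j₀))
    eq = proj₂ (proj₂ (covered i₀ j₀))
    base≡ : base i₀ ≡ x₀
    base≡ = trans (cong (λ (_ , q) → proj₁ (remQuot {P} b q)) (remQuot-combine (fromℕ< 1≤M) _))
                  (cong proj₁ (remQuot-combine x₀ (fromℕ< 1≤b)))
    level≡ : toℕ (level i₀) ≡ 0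
    level≡ = trans
      (cong toℕ (trans (cong (λ (_ , q) → proj₂ (remQuot {P} b q)) (remQuot-combine (fromℕ< 1≤M) _))
                       (cong proj₂ (remQuot-combine x₀ (fromℕ< 1≤b)))))
      (toℕ-fromℕ< 1≤b)
    coord₀ : ∀ e → coord (base i₀) e ≈ b * δ e (combine l (lookup (w σ) l)) [mod p ]
    coord₀ e = mod-trans (mod-reflexive (trans (cong (λ x → coord x e) base≡)
        (cong toℕ (finToFun-funToFin {m * 8} {p} _ e))))
      (toℕ-mod _)
    along₀ : ∀ v → ∑along v (coord (base i₀)) ≈ b * δ (lookup v l) (lookup (w σ) l) [mod p ]
    along₀ v = mod-trans (mod-sum λ i → coord₀ (combine i (lookup v i)))
      (mod-reflexive (trans
        (sym (*-distribˡ-sum b (λ i → δ (combine i (lookup v i)) (combine l (lookup (w σ) l)))))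
        (cong (b *_) (∑along-point v (w σ) l))))
    j′≡j₀ : j′ ≡ j₀
    j′≡j₀ = same-part τ σ i′ i₀ j′ j₀ eq
    moved≡ : ∀ υ i {j} e → toℕ j ≡ 0 → moved υ i j e ≡ coord (base i) e
    moved≡ υ i {j} e j≡0 =
      trans (cong (λ j → coord (base i) e + j * indicator (w υ) e) j≡0) (+-identityʳ _)
    height≡0 : height τ i′ ≈ 0 [mod p ]
    height≡0 = mod-trans (mod-sum λ i → subst₂ _≈_[mod p ]
        (moved≡ τ i′ (e i) (trans (cong toℕ j′≡j₀) (toℕ-fromℕ< 1≤k)))
        (moved≡ σ i₀ (e i) (toℕ-fromℕ< 1≤k))
        (same-moved τ σ i′ i₀ j′ j₀ eq (e i)))
      (mod-trans (along₀ (w τ)) (mod-reflexive (trans (cong (b *_) (δ-≢ apart)) (*-zeroʳ b))))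
      where
      e : Fin m → Fin (m * 8)
      e i = combine i (lookup (w τ) i)
    height≡b : height σ i₀ ≈ b [mod p ]
    height≡b = mod-trans (along₀ (w σ))
      (mod-reflexive (trans (cong (b *_) (δ-refl (lookup (w σ) l))) (*-identityʳ b)))
    u′≡b : toℕ (level i′) ≈ b [mod p ]
    u′≡b = mod-trans (mod-+ (mod-sym height≡0) (mod-reflexive {c = toℕ (level i′)} refl))
      (mod-trans (same-height τ σ i′ i₀ j′ j₀ eq)
        (subst (height σ i₀ + toℕ (level i₀) ≈_[mod p ])
          (trans (cong (λ s → b + s) level≡) (+-identityʳ b)) (mod-+ height≡b (mod-reflexive refl))))

  separated : ∀ τ σ → (∀ i j → ∃₂ λ i′ j′ → vertex τ i′ j′ ≡ vertex σ i j) → τ ≡ σ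
  separated τ σ covered = decidable-stable (τ ≟ σ) λ τ≢σ →
    let l , apart = differ (w τ) (w σ) (≤-<-trans (sparse τ≢σ) b<m)
    in  clusters-differ τ σ l apart covered

-- Choice of the parameters

n<2^[1+lg] : ∀ n → n < 2 ^ suc (lg n)
n<2^[1+lg] n = ≰⇒> λ 2^≤n → 1+n≰n
  (subst (_≤ lg n) (⌊log₂[2^n]⌋≡n (suc (lg n))) (⌊log₂⌋-mono-≤ 2^≤n))

2^lg≤n : ∀ n → 1 ≤ n → 2 ^ lg n ≤ n
2^lg≤n = <-rec (λ n → 1 ≤ n → 2 ^ lg n ≤ n) step
  where
  open ≤-Reasoning
  step : ∀ n → (∀ {m} → m < n → 1 ≤ m → 2 ^ lg m ≤ m) → 1 ≤ n → 2 ^ lg n ≤ n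
  step 1 _ _ = ≤-refl
  step n@(suc (suc n-2)) ih _ = begin
    2 ^ lg n                      ≤⟨ ^-monoʳ-≤ 2 (m≤n+m∸n (lg n) 1) ⟩
    2 * 2 ^ (lg n ∸ 1)            ≡⟨ cong (λ l → 2 * 2 ^ l) (⌊log₂⌊n/2⌋⌋≡⌊log₂n⌋∸1 n) ⟨
    2 * 2 ^ lg ⌊ n /2⌋            ≤⟨ *-monoʳ-≤ 2 (ih (⌊n/2⌋<n (suc n-2)) (s≤s z≤n)) ⟩
    2 * ⌊ n /2⌋                   ≡⟨ cong (λ h → ⌊ n /2⌋ + h) (+-identityʳ ⌊ n /2⌋) ⟩
    ⌊ n /2⌋ + ⌊ n /2⌋             ≤⟨ +-monoʳ-≤ ⌊ n /2⌋ (⌊n/2⌋≤⌈n/2⌉ n) ⟩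
    ⌊ n /2⌋ + ⌈ n /2⌉             ≡⟨ ⌊n/2⌋+⌈n/2⌉≡n n ⟩
    n                             ∎

-- The order of one copy: k parts, each ℤ_p × ℤ_p^(2b × 8).
blockOrder : (k b : ℕ) → ℕ
blockOrder k b = let p = k * (2 * b) in k * (p * p ^ (2 * b * 8))

-- With this b, the graph on blockOrder vertices has order at most
-- 2^(35 b (lglg n + 1)) ≤ √n.
halfLength : ℕ → ℕ
halfLength n = lg n / (70 * suc (lglg n))

-- From 4 ≤ n follows lglg n ≥ 1, hence ℓ + 1 ≤ 2 ℓ; the factor 140 = 2 · 70 then gives L ≥ 70 (ℓ +
-- 1), that is b ≥ 1.
module _ (n k : ℕ) (4≤n : 4 ≤ n) (1≤k : 1 ≤ k) (k≤ : 140 * (k * lglg n) ≤ lg n) where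
  private
    L = lg n
    ℓ = lglg n
    b = halfLength n
    p = k * (2 * b)

  1≤lglg : 1 ≤ ℓ
  1≤lglg = ⌊log₂⌋-mono-≤ (⌊log₂⌋-mono-≤ 4≤n)

  140ℓ≤L : 140 * ℓ ≤ L
  140ℓ≤L = ≤-trans (*-monoʳ-≤ 140 (m≤n*m ℓ k {{>-nonZero 1≤k}})) k≤

  1+ℓ≤2ℓ : suc ℓ ≤ 2 * ℓ
  1+ℓ≤2ℓ = +-mono-≤ 1≤lglg (≤-reflexive (sym (+-identityʳ ℓ)))

  b*≤L : b * (70 * suc ℓ) ≤ L
  b*≤L = m/n*n≤m L (70 * suc ℓ)

  L<[1+b]* : L < suc b * (70 * suc ℓ)
  L<[1+b]* = subst (_< suc b * (70 * suc ℓ)) (sym (m≡m%n+[m/n]*n L (70 * suc ℓ)))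
    (+-monoˡ-< (b * (70 * suc ℓ)) (m%n<n L (70 * suc ℓ)))

  1≤halfLength : 1 ≤ b
  1≤halfLength = ≮⇒≥ λ b<1 → <⇒≱ L<[1+b]* (begin
    suc b * (70 * suc ℓ)  ≤⟨ *-monoˡ-≤ (70 * suc ℓ) b<1 ⟩
    1 * (70 * suc ℓ)      ≡⟨ *-identityˡ (70 * suc ℓ) ⟩
    70 * suc ℓ            ≤⟨ *-monoʳ-≤ 70 1+ℓ≤2ℓ ⟩
    70 * (2 * ℓ)          ≡⟨ *-assoc 70 2 ℓ ⟨
    140 * ℓ               ≤⟨ 140ℓ≤L ⟩
    L                     ∎)
    where open ≤-Reasoning

  private
    -- ℓ is the rounded logarithm of L, so L < 2 ^ (ℓ + 1); this is applied to k and to 2 b.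
    ≤L⇒≤2^ : ∀ {m} → m ≤ L → m ≤ 2 ^ suc ℓ
    ≤L⇒≤2^ m≤L = ≤-trans m≤L (<⇒≤ (n<2^[1+lg] L))

    k≤2^ : k ≤ 2 ^ suc ℓ
    k≤2^ = ≤L⇒≤2^ (≤-trans (m≤m*n k ℓ {{>-nonZero 1≤lglg}}) (≤-trans (m≤n*m (k * ℓ) 140) k≤))

    2b≤2^ : 2 * b ≤ 2 ^ suc ℓ
    2b≤2^ = ≤L⇒≤2^ (begin
      2 * b             ≡⟨ *-comm 2 b ⟩
      b * 2             ≤⟨ *-monoʳ-≤ b (≤-trans (≤ᵇ⇒≤ 2 70 _) (m≤m*n 70 (suc ℓ))) ⟩
      b * (70 * suc ℓ)  ≤⟨ b*≤L ⟩
      L                 ∎)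
      where open ≤-Reasoning

    p≤2^ : p ≤ 2 ^ (suc ℓ + suc ℓ)
    p≤2^ = subst (p ≤_) (sym (^-distribˡ-+-* 2 (suc ℓ) (suc ℓ))) (*-mono-≤ k≤2^ 2b≤2^)

  -- In units of ℓ + 1 the exponent is 1 for k plus 2 for each of 16 b + 1 factors p; since b ≥ 1,
  -- the total 3 + 32 b is at most 35 b.
  blockOrder≤ : blockOrder k b ≤ 2 ^ (35 * b * suc ℓ)
  blockOrder≤ = begin
    k * p ^ suc (2 * b * 8)
      ≤⟨ *-mono-≤ k≤2^ (^-monoˡ-≤ (suc (2 * b * 8)) p≤2^) ⟩
    2 ^ suc ℓ * (2 ^ (suc ℓ + suc ℓ)) ^ suc (2 * b * 8)
      ≡⟨ cong (2 ^ suc ℓ *_) (^-*-assoc 2 (suc ℓ + suc ℓ) (suc (2 * b * 8))) ⟩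
    2 ^ suc ℓ * 2 ^ ((suc ℓ + suc ℓ) * suc (2 * b * 8))
      ≡⟨ ^-distribˡ-+-* 2 (suc ℓ) ((suc ℓ + suc ℓ) * suc (2 * b * 8)) ⟨
    2 ^ (suc ℓ + (suc ℓ + suc ℓ) * suc (2 * b * 8))
      ≤⟨ ^-monoʳ-≤ 2 exponent ⟩
    2 ^ (35 * b * suc ℓ) ∎
    where
    open ≤-Reasoning
    exponent : suc ℓ + (suc ℓ + suc ℓ) * suc (2 * b * 8) ≤ 35 * b * suc ℓ
    exponent = begin
      suc ℓ + (suc ℓ + suc ℓ) * suc (2 * b * 8)
        ≡⟨ solve 2 (λ l b → l :+ (l :+ l) :* (con 1 :+ con 2 :* b :* con 8)
                         := con 3 :* l :+ con 32 :* b :* l) refl (suc ℓ) b ⟩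
      3 * suc ℓ + 32 * b * suc ℓ
        ≤⟨ +-monoˡ-≤ (32 * b * suc ℓ) (*-monoˡ-≤ (suc ℓ) (m≤m*n 3 b {{>-nonZero 1≤halfLength}})) ⟩
      3 * b * suc ℓ + 32 * b * suc ℓ
        ≡⟨ solve 2 (λ l b → con 3 :* b :* l :+ con 32 :* b :* l := con 35 :* b :* l) refl (suc ℓ) b ⟩
      35 * b * suc ℓ ∎

  -- Squaring doubles 35 to the 70 in `halfLength`.
  blockOrder²≤n : blockOrder k b * blockOrder k b ≤ n
  blockOrder²≤n = begin
    blockOrder k b * blockOrder k b
      ≤⟨ *-mono-≤ blockOrder≤ blockOrder≤ ⟩
    2 ^ (35 * b * suc ℓ) * 2 ^ (35 * b * suc ℓ)
      ≡⟨ ^-distribˡ-+-* 2 (35 * b * suc ℓ) (35 * b * suc ℓ) ⟨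
    2 ^ (35 * b * suc ℓ + 35 * b * suc ℓ)
      ≡⟨ cong (2 ^_) (solve 2 (λ l b → con 35 :* b :* l :+ con 35 :* b :* l := b :* (con 70 :* l))
                              refl (suc ℓ) b) ⟩
    2 ^ (b * (70 * suc ℓ))
      ≤⟨ ^-monoʳ-≤ 2 b*≤L ⟩
    2 ^ L
      ≤⟨ 2^lg≤n n (≤-trans (s≤s z≤n) 4≤n) ⟩
    n ∎
    where open ≤-Reasoning

  -- Rounding costs two factors 2, from b + 1 ≤ 2 b and ℓ + 1 ≤ 2 ℓ, which turn 70 into 280.
  n≤2^halfLength^ : ∀ {t} → 2 ^ b ≤ t → n ≤ t ^ (280 * ℓ)
  n≤2^halfLength^ {t} 2^b≤t = begin
    n                       ≤⟨ <⇒≤ (n<2^[1+lg] n) ⟩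
    2 ^ suc L               ≤⟨ ^-monoʳ-≤ 2 exponent ⟩
    2 ^ (b * (280 * ℓ))     ≡⟨ ^-*-assoc 2 b (280 * ℓ) ⟨
    (2 ^ b) ^ (280 * ℓ)     ≤⟨ ^-monoˡ-≤ (280 * ℓ) 2^b≤t ⟩
    t ^ (280 * ℓ)           ∎
    where
    open ≤-Reasoning
    exponent : suc L ≤ b * (280 * ℓ)
    exponent = begin
      suc L
        ≤⟨ L<[1+b]* ⟩
      suc b * (70 * suc ℓ)
        ≤⟨ *-mono-≤ (+-monoˡ-≤ b 1≤halfLength) (*-monoʳ-≤ 70 1+ℓ≤2ℓ) ⟩
      (b + b) * (70 * (2 * ℓ))
        ≡⟨ solve 2 (λ b ℓ → (b :+ b) :* (con 70 :* (con 2 :* ℓ)) := b :* (con 280 :* ℓ)) refl b ℓ ⟩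
      b * (280 * ℓ) ∎

-- The error term and the number of copies

-- 1 − a c / n; the value at n = 0 is irrelevant.
deficit : (a c n : ℕ) → ℚ
deficit a c zero      = 0ℚ
deficit a c n@(suc _) = (+ n ℤ.- + a ℤ.* + c) ℚ./ n

-- Passing to unnormalised rationals removes the reduction to lowest terms and leaves a polynomial
-- identity over ℤ.
deficit-correct : ∀ a c n → 1 ≤ n → fromℕ a ℚ.* fromℕ c ≡ fromℕ n ℚ.* (1ℚ ℚ.- deficit a c n)
deficit-correct a c n@(suc n-1) _ = ℚ.toℚᵘ-injective (begin
  toℚᵘ (fromℕ a ℚ.* fromℕ c)
    ≈⟨ ℚ.toℚᵘ-homo-* (fromℕ a) (fromℕ c) ⟩
  toℚᵘ (fromℕ a) ℚᵘ.* toℚᵘ (fromℕ c)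
    ≈⟨ ℚᵘ.*-cong (ℚ.toℚᵘ-fromℚᵘ (mkℚᵘ (+ a) 0)) (ℚ.toℚᵘ-fromℚᵘ (mkℚᵘ (+ c) 0)) ⟩
  mkℚᵘ (+ a) 0 ℚᵘ.* mkℚᵘ (+ c) 0
    ≈⟨ ℚᵘ.*≡* identity ⟩
  mkℚᵘ (+ n) 0 ℚᵘ.* (ℚᵘ.1ℚᵘ ℚᵘ.- mkℚᵘ D n-1)
    ≈⟨ ℚᵘ.*-cong (ℚ.toℚᵘ-fromℚᵘ (mkℚᵘ (+ n) 0))
                 (ℚᵘ.+-congʳ ℚᵘ.1ℚᵘ (ℚᵘ.-‿cong (ℚ.toℚᵘ-fromℚᵘ (mkℚᵘ D n-1)))) ⟨
  toℚᵘ (fromℕ n) ℚᵘ.* (ℚᵘ.1ℚᵘ ℚᵘ.- toℚᵘ d)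
    ≈⟨ ℚᵘ.*-congˡ {toℚᵘ (fromℕ n)} (ℚᵘ.+-congʳ ℚᵘ.1ℚᵘ (ℚ.toℚᵘ-homo‿- d)) ⟨
  toℚᵘ (fromℕ n) ℚᵘ.* (ℚᵘ.1ℚᵘ ℚᵘ.+ toℚᵘ (ℚ.- d))
    ≈⟨ ℚᵘ.*-congˡ {toℚᵘ (fromℕ n)} (ℚ.toℚᵘ-homo-+ 1ℚ (ℚ.- d)) ⟨
  toℚᵘ (fromℕ n) ℚᵘ.* toℚᵘ (1ℚ ℚ.- d)
    ≈⟨ ℚ.toℚᵘ-homo-* (fromℕ n) (1ℚ ℚ.- d) ⟨
  toℚᵘ (fromℕ n ℚ.* (1ℚ ℚ.- d)) ∎)
  where
  open ℚᵘ.≃-Reasoning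
  D = + n ℤ.- + a ℤ.* + c
  d = deficit a c n
  identity : (+ a ℤ.* + c) ℤ.* + (1 * (1 * n)) ≡ + n ℤ.* (+ 1 ℤ.* + n ℤ.+ ℤ.- D ℤ.* + 1) ℤ.* + 1
  identity = trans (cong (λ m → (+ a ℤ.* + c) ℤ.* + m) (trans (*-identityˡ (1 * n)) (*-identityˡ n)))
    (ℤS.solve 3 (λ a c n → (a ℤS.:* c) ℤS.:* n ℤS.:=
      n ℤS.:* (ℤS.con (+ 1) ℤS.:* n ℤS.:+ ℤS.:- (n ℤS.:- a ℤS.:* c) ℤS.:* ℤS.con (+ 1)) ℤS.:* ℤS.con (+ 1))
      refl (+ a) (+ c) (+ n))

-- A positive `ε` has numerator at least 1, so it is at least the reciprocal of its denominator.
deficit-small : ∀ a c n ε → 0ℚ ℚ.< ε → 1 ≤ n → a * c ≤ n → ℚ.↧ₙ ε * (n ∸ a * c) ≤ n →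
  ℚ.∣ deficit a c n ∣ ℚ.≤ ε
deficit-small _ _ _ (mkℚ (+ 0)    _ _) (ℚ.*<* (ℤ.+<+ ()))
deficit-small _ _ _ (mkℚ -[1+ _ ] _ _) (ℚ.*<* ())
deficit-small a c n@(suc n-1) ε@(mkℚ +[1+ x ] q-1 _) _ _ ac≤n small = ℚ.toℚᵘ-cancel-≤ (begin
  toℚᵘ ℚ.∣ deficit a c n ∣
    ≃⟨ ℚ.toℚᵘ-homo-∣-∣ (deficit a c n) ⟩
  ℚᵘ.∣ toℚᵘ (deficit a c n) ∣
    ≃⟨ ℚᵘ.∣-∣-cong (ℚ.toℚᵘ-fromℚᵘ (mkℚᵘ (+ n ℤ.- + a ℤ.* + c) n-1)) ⟩
  ℚᵘ.∣ mkℚᵘ (+ n ℤ.- + a ℤ.* + c) n-1 ∣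
    ≡⟨ cong (λ d → ℚᵘ.∣ mkℚᵘ d n-1 ∣) D≡ ⟩
  mkℚᵘ (+ (n ∸ a * c)) n-1
    ≤⟨ ℚᵘ.*≤* (subst₂ ℤ._≤_ (ℤ.pos-* (n ∸ a * c) (suc q-1)) (ℤ.pos-* (suc x) n) (ℤ.+≤+ bound)) ⟩
  mkℚᵘ +[1+ x ] q-1 ∎)
  where
  open ℚᵘ.≤-Reasoning
  D≡ : + n ℤ.- + a ℤ.* + c ≡ + (n ∸ a * c)
  D≡ = trans (cong (λ m → + n ℤ.- m) (sym (ℤ.pos-* a c)))
             (trans (ℤ.m-n≡m⊖n n (a * c)) (ℤ.⊖-≥ ac≤n))
  bound : (n ∸ a * c) * suc q-1 ≤ suc x * n
  bound = ≤-trans (≤-reflexive (*-comm (n ∸ a * c) (suc q-1))) (≤-trans small (m≤m+n n (x * n)))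

-- n / d, with the divisor kept positive because d may be 0 for small n.
copies : (n d : ℕ) → ℕ
copies n d = n / suc (pred d)

copies*≤ : ∀ n {d} → 1 ≤ d → copies n d * d ≤ n
copies*≤ n {d@(suc _)} _ = m/n*n≤m n d

n∸copies*≤ : ∀ n {d} → 1 ≤ d → n ∸ copies n d * d ≤ d
n∸copies*≤ n {d@(suc _)} _ = subst (_≤ d) (m%n≡m∸m/n*n n d) (<⇒≤ (m%n<n n d))

1≤copies : ∀ {n d} → 1 ≤ d → d ≤ n → 1 ≤ copies n d
1≤copies {d = suc _} _ d≤n = m≥n⇒m/n>0 d≤n

-- The constant in the exponent of t is chosen before `k`, hence uniform in it; the little-o
-- hypothesis is applied with the factor 140.
theorem2 : ∃ λ (C : ℕ) → (k : ℕ → ℕ) → (∀ n → 1 ≤ n → 1 ≤ k n) → k =o[ lg / lglg ] →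
    ∃ λ (r : ℕ → ℕ) → ∃ λ (t : ℕ → ℕ) →
    r =n/2 k ²[1-o[1]] ×
    t ≥n^[1/ C loglog] ×
    Eventually (λ n → Σ (Graph n) (IsClusterPacking (r n) (t n) (k n)))
theorem2 = 280 , λ k 1≤k k=o → construction k 1≤k (proj₁ (k=o 140)) (proj₂ (k=o 140))
  where
  construction : ∀ k → (∀ n → 1 ≤ n → 1 ≤ k n) → ∀ N → (∀ n → N ≤ n → 140 * (k n * lglg n) ≤ lg n) →
    ∃ λ (r : ℕ → ℕ) → ∃ λ (t : ℕ → ℕ) →
    r =n/2 k ²[1-o[1]] ×
    t ≥n^[1/ 280 loglog] ×
    Eventually (λ n → Σ (Graph n) (IsClusterPacking (r n) (t n) (k n)))
  construction k 1≤k N k≤ =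
    r , t ,
    ((λ n → deficit (2 * k n ^ 2) (r n) n) , δ→0 , λ n → deficit-correct (2 * k n ^ 2) (r n) n) ,
    (N ⊔ 4 , λ n big →
      n≤2^halfLength^ n (k n) (4≤ big) (1≤k′ big) (k≤′ big) (2^b≤t n)) ,
    (N ⊔ 4 , λ n big → packing (design n big) (1≤r n big) (1≤t n) (1≤k′ big))
    where
    t M r d : ℕ → ℕ
    t n = proj₁ (code-exists (halfLength n))
    d n = blockOrder (k n) (halfLength n)
    M n = copies n (d n)
    r n = M n * ((k n * (2 * halfLength n)) ^ (2 * halfLength n * 8) * halfLength n)

    4≤ : ∀ {n} → N ⊔ 4 ≤ n → 4 ≤ n
    4≤ = ≤-trans (m≤n⊔m N 4)

    1≤k′ : ∀ {n} → N ⊔ 4 ≤ n → 1 ≤ k n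
    1≤k′ big = 1≤k _ (≤-trans (s≤s z≤n) (4≤ big))

    k≤′ : ∀ {n} → N ⊔ 4 ≤ n → 140 * (k n * lglg n) ≤ lg n
    k≤′ big = k≤ _ (≤-trans (m≤m⊔n N 4) big)

    1≤b : ∀ n → N ⊔ 4 ≤ n → 1 ≤ halfLength n
    1≤b n big = 1≤halfLength n (k n) (4≤ big) (1≤k′ big) (k≤′ big)

    d²≤n : ∀ n → N ⊔ 4 ≤ n → d n * d n ≤ n
    d²≤n n big = blockOrder²≤n n (k n) (4≤ big) (1≤k′ big) (k≤′ big)

    2^b≤t : ∀ n → 2 ^ halfLength n ≤ t n
    2^b≤t n = proj₁ (proj₂ (code-exists (halfLength n)))

    1≤t : ∀ n → 1 ≤ t n
    1≤t n = ≤-trans (m^n>0 2 (halfLength n)) (2^b≤t n)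

    1≤p^ : ∀ n → N ⊔ 4 ≤ n → ∀ e → 1 ≤ (k n * (2 * halfLength n)) ^ e
    1≤p^ n big e = m^n>0 (k n * (2 * halfLength n))
      {{>-nonZero (*-mono-≤ (1≤k′ big) (≤-trans (1≤b n big) (m≤m+n (halfLength n) _)))}} e

    1≤d : ∀ n → N ⊔ 4 ≤ n → 1 ≤ d n
    1≤d n big = *-mono-≤ (1≤k′ big) (1≤p^ n big (suc (2 * halfLength n * 8)))

    1≤M : ∀ n → N ⊔ 4 ≤ n → 1 ≤ M n
    1≤M n big = 1≤copies (1≤d n big)
      (≤-trans (m≤m*n (d n) (d n) {{>-nonZero (1≤d n big)}}) (d²≤n n big))

    1≤r : ∀ n → N ⊔ 4 ≤ n → 1 ≤ r n
    1≤r n big = *-mono-≤ (1≤M n big) (*-mono-≤ (1≤p^ n big (2 * halfLength n * 8)) (1≤b n big))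

    design : ∀ n → N ⊔ 4 ≤ n → Design n (r n) (t n) (k n)
    design n big = let _ , _ , w , sparse = code-exists (halfLength n) in
      torusDesign (halfLength n) (k n) (M n) (2 * halfLength n) (k n * (2 * halfLength n)) refl refl
        (1≤b n big) (1≤k′ big) (1≤M n big) w sparse (copies*≤ n (1≤d n big))

    -- The ratio 1 / 2k² is exact on the copies, so the whole error comes from the vertices left
    -- over.
    2k²r≡Md : ∀ n → 2 * k n ^ 2 * r n ≡ M n * d n
    2k²r≡Md n = solve 4 (λ k M P b →
      con 2 :* (k :* (k :* con 1)) :* (M :* (P :* b)) := M :* (k :* (k :* (con 2 :* b) :* P)))
      refl (k n) (M n) ((k n * (2 * halfLength n)) ^ (2 * halfLength n * 8)) (halfLength n)

    -- The product is at most the square of the larger factor, and both squares are at most n.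
    e*d≤n : ∀ e n → N ⊔ 4 ≤ n → e * e ≤ n → e * d n ≤ n
    e*d≤n e n big e²≤n with ≤-total e (d n)
    ... | inj₁ e≤d = ≤-trans (*-monoˡ-≤ (d n) e≤d) (d²≤n n big)
    ... | inj₂ d≤e = ≤-trans (*-monoʳ-≤ e d≤e) e²≤n

    δ→0 : (λ n → deficit (2 * k n ^ 2) (r n) n) =o[1]
    -- Fewer than d n vertices are left over, and with e the denominator of `ε`, n ≥ e² makes e · d
    -- n ≤ n.
    δ→0 ε 0<ε = N ⊔ 4 ⊔ e * e , λ n large →
      let big = ≤-trans (m≤m⊔n (N ⊔ 4) (e * e)) large
          e²≤n  = ≤-trans (m≤n⊔m (N ⊔ 4) (e * e)) large
      in deficit-small (2 * k n ^ 2) (r n) n ε 0<ε (≤-trans (s≤s z≤n) (4≤ big))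
           (subst (_≤ n) (sym (2k²r≡Md n)) (copies*≤ n (1≤d n big)))
           (≤-trans (*-monoʳ-≤ e (subst (λ x → n ∸ x ≤ d n) (sym (2k²r≡Md n))
                                    (n∸copies*≤ n (1≤d n big))))
                    (e*d≤n e n big e²≤n))
      where
      e = ℚ.↧ₙ ε
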